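{- Let $\alpha,\beta,\gamma\in\mathcal{L}$ be Lipschitz integers such that $\beta\perp\alpha$ and $\gamma\perp\alpha$. Then $$\alpha\times\beta\times\gamma\in\alpha\mathcal{L}\cap\mathcal{L}\alpha .$$
   Context: $\mathbb{H}$ is the real quaternion algebra with basis $1,i,j,k$ ($i^2=j^2=k^2=ijk=-1$), identified with $\mathbb{R}^4$ via $(1,i,j,k)=(\mathbf{e}_1,\mathbf{e}_2,\mathbf{e}_3,\mathbf{e}_4)$. $\mathcal{L}=\mathbb{Z}+\mathbb{Z}i+\mathbb{Z}j+\mathbb{Z}k$ is the ring of Lipschitz integers; $\alpha\mathcal{L}=\{\alpha x: x\in\mathcal{L}\}$ and $\mathcal{L}\alpha=\{x\alpha: x\in\mathcal{L}\}$. $u\perp v$ means $u\cdot v=0$ for the standard inner product of $\mathbb{R}^4$. The ternary vector product of $u,v,w\in\mathbb{H}$, with $u=u_0+u_1i+u_2j+u_3k$ and similarly for $v,w$, is $$u\times v\times w=\begin{vmatrix}u_0&u_1&u_2&u_3\\ v_0&v_1&v_2&v_3\\ w_0&w_1&w_2&w_3\\ 1&i&j&k\end{vmatrix},$$ the formal determinant being computed by Laplace expansion along the last row. -}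

module Defs where

open import Data.Integer using (ℤ; 0ℤ; 1ℤ; -1ℤ; _+_; _-_; _*_; -_)
open import Data.Product using (∃-syntax)
open import Level using (0ℓ)
open import Relation.Binary.PropositionalEquality using (_≡_; refl)
open import Relation.Unary using (Pred)

-- The Lipschitz integers.  As 1, i, j, k is a basis of ℍ, the elements of
-- ℤ + ℤi + ℤj + ℤk are exactly the quadruples of integer coordinates:
-- quat a b c d is a + b i + c j + d k.

record 𝓛 : Set where
  constructor quat
  field
    x₀ x₁ x₂ x₃ : ℤ

infixl 7 _⊛_ _·_
infix  4 _⟂_

-- Quaternion multiplication: the bilinear extension of
-- i² = j² = k² = ijk = -1.

_⊛_ : 𝓛 → 𝓛 → 𝓛
quat a₀ a₁ a₂ a₃ ⊛ quat b₀ b₁ b₂ b₃ = quat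
  (a₀ * b₀ - a₁ * b₁ - a₂ * b₂ - a₃ * b₃)
  (a₀ * b₁ + a₁ * b₀ + a₂ * b₃ - a₃ * b₂)
  (a₀ * b₂ - a₁ * b₃ + a₂ * b₀ + a₃ * b₁)
  (a₀ * b₃ + a₁ * b₂ - a₂ * b₁ + a₃ * b₀)

-- The restriction to 𝓛 of the standard inner product of ℝ⁴.

_·_ : 𝓛 → 𝓛 → ℤ
quat a₀ a₁ a₂ a₃ · quat b₀ b₁ b₂ b₃ = a₀ * b₀ + a₁ * b₁ + a₂ * b₂ + a₃ * b₃

_⟂_ : 𝓛 → 𝓛 → Set
u ⟂ v = u · v ≡ 0ℤ

-- det₃ lists the entries of the matrix row by row.

det₃ : (a b c d e f g h l : ℤ) → ℤ
det₃ a b c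
     d e f
     g h l = a * (e * l - f * h) - b * (d * l - f * g) + c * (d * h - e * g)

-- Laplace expansion, along the last row (1, i, j, k), of the formal 4 × 4
-- determinant with first three rows u, v, w.  The cofactor signs (-1)^(4+m)
-- are -, +, -, +.

_×_×_ : 𝓛 → 𝓛 → 𝓛 → 𝓛
quat u₀ u₁ u₂ u₃ × quat v₀ v₁ v₂ v₃ × quat w₀ w₁ w₂ w₃ = quat
  (- det₃ u₁ u₂ u₃
          v₁ v₂ v₃
          w₁ w₂ w₃)
  (det₃ u₀ u₂ u₃
        v₀ v₂ v₃
        w₀ w₂ w₃)
  (- det₃ u₀ u₁ u₃
          v₀ v₁ v₃
          w₀ w₁ w₃)
  (det₃ u₀ u₁ u₂
        v₀ v₁ v₂
        w₀ w₁ w₂)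

-- The sets α𝓛 and 𝓛α.

_⊛𝓛 : 𝓛 → Pred 𝓛 0ℓ
(α ⊛𝓛) y = ∃[ x ] y ≡ α ⊛ x

𝓛⊛_ : 𝓛 → Pred 𝓛 0ℓ
(𝓛⊛ α) y = ∃[ x ] y ≡ x ⊛ α

private
  one i j k -one : 𝓛
  one  = quat 1ℤ 0ℤ 0ℤ 0ℤ
  i    = quat 0ℤ 1ℤ 0ℤ 0ℤ
  j    = quat 0ℤ 0ℤ 1ℤ 0ℤ
  k    = quat 0ℤ 0ℤ 0ℤ 1ℤ
  -one = quat -1ℤ 0ℤ 0ℤ 0ℤ

  i² : i ⊛ i ≡ -one
  i² = refl

  j² : j ⊛ j ≡ -one
  j² = refl

  k² : k ⊛ k ≡ -one
  k² = refl

  ijk : i ⊛ j ⊛ k ≡ -one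
  ijk = refl

  ij : i ⊛ j ≡ k
  ij = refl

  jk : j ⊛ k ≡ i
  jk = refl

  ki : k ⊛ i ≡ j
  ki = refl

  1×i×j : one × i × j ≡ k
  1×i×j = refl

-- Write ū for the conjugate of u.  In 𝓛, u·v is the real part of ū v and of
-- v ū, and 2 (α × β × γ) = γ β̄ α - α β̄ γ.  Moving α to the left through
-- γ β̄ α with the rules ū v = 2 (u·v) - v̄ u and u v̄ = 2 (u·v) - v ū, or to
-- the right through α β̄ γ, gives
--   α × β × γ = α Im(γ̄ β) + (β·α) γ - (γ·α) β
--             = Im(γ β̄) α - (β·α) γ + (γ·α) β,
-- where Im denotes the vector part, which has integer coordinates.

module Submission where

open import Defs
open import Data.Integer using (ℤ; 0ℤ; _+_; _*_; -_)
open import Data.Integer.Properties using (+-identityʳ)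
open import Data.Integer.Solver using (module +-*-Solver)
open import Data.Nat using (ℕ)
open import Data.Product using (_,_) renaming (_×_ to _and_)
open import Relation.Binary.PropositionalEquality
  using (_≡_; refl; trans; cong)
open import Relation.Unary using (_∈_; _∩_)

infixl 6 _⊞_
infixl 7 _∙_

_⊞_ : 𝓛 → 𝓛 → 𝓛
quat a₀ a₁ a₂ a₃ ⊞ quat b₀ b₁ b₂ b₃ =
  quat (a₀ + b₀) (a₁ + b₁) (a₂ + b₂) (a₃ + b₃)

_∙_ : ℤ → 𝓛 → 𝓛
n ∙ quat a₀ a₁ a₂ a₃ = quat (n * a₀) (n * a₁) (n * a₂) (n * a₃)

conj : 𝓛 → 𝓛
conj (quat a₀ a₁ a₂ a₃) = quat a₀ (- a₁) (- a₂) (- a₃)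

Im : 𝓛 → 𝓛
Im (quat a₀ a₁ a₂ a₃) = quat 0ℤ a₁ a₂ a₃

quat-cong : ∀ {a₀ a₁ a₂ a₃ b₀ b₁ b₂ b₃} →
  a₀ ≡ b₀ → a₁ ≡ b₁ → a₂ ≡ b₂ → a₃ ≡ b₃ →
  quat a₀ a₁ a₂ a₃ ≡ quat b₀ b₁ b₂ b₃
quat-cong refl refl refl refl = refl

∙-vanishes : ∀ {m n} x u v → m ≡ 0ℤ → n ≡ 0ℤ → x ⊞ m ∙ u ⊞ n ∙ v ≡ x
-- Once `m` and `n` are `0ℤ`, each product `0ℤ * a` computes to `0ℤ`, so only the two added zeros
-- remain.
∙-vanishes x u v refl refl = quat-cong (drop _) (drop _) (drop _) (drop _)
  where
  drop : ∀ n → n + 0ℤ + 0ℤ ≡ n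
  drop n = trans (+-identityʳ (n + 0ℤ)) (+-identityʳ n)

-- The operations on quaternions with polynomial coordinates, whose
-- evaluations are definitionally the operations on 𝓛.

module Symbolic {n : ℕ} where
  open +-*-Solver

  record Quat : Set where
    constructor quat
    field
      p₀ p₁ p₂ p₃ : Polynomial n

  open Quat public

  infixl 6 _⊕_
  infixl 7 _⊗_ _·ₚ_ _∙ₚ_

  _⊗_ _⊕_ : Quat → Quat → Quat
  quat a₀ a₁ a₂ a₃ ⊗ quat b₀ b₁ b₂ b₃ = quat
    (a₀ :* b₀ :- a₁ :* b₁ :- a₂ :* b₂ :- a₃ :* b₃)
    (a₀ :* b₁ :+ a₁ :* b₀ :+ a₂ :* b₃ :- a₃ :* b₂)
    (a₀ :* b₂ :- a₁ :* b₃ :+ a₂ :* b₀ :+ a₃ :* b₁)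
    (a₀ :* b₃ :+ a₁ :* b₂ :- a₂ :* b₁ :+ a₃ :* b₀)
  quat a₀ a₁ a₂ a₃ ⊕ quat b₀ b₁ b₂ b₃ =
    quat (a₀ :+ b₀) (a₁ :+ b₁) (a₂ :+ b₂) (a₃ :+ b₃)

  _·ₚ_ : Quat → Quat → Polynomial n
  quat a₀ a₁ a₂ a₃ ·ₚ quat b₀ b₁ b₂ b₃ =
    a₀ :* b₀ :+ a₁ :* b₁ :+ a₂ :* b₂ :+ a₃ :* b₃

  _∙ₚ_ : Polynomial n → Quat → Quat
  m ∙ₚ quat a₀ a₁ a₂ a₃ = quat (m :* a₀) (m :* a₁) (m :* a₂) (m :* a₃)

  conjₚ Imₚ : Quat → Quat
  conjₚ (quat a₀ a₁ a₂ a₃) = quat a₀ (:- a₁) (:- a₂) (:- a₃)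
  Imₚ (quat a₀ a₁ a₂ a₃) = quat (con 0ℤ) a₁ a₂ a₃

  detₚ : (a b c d e f g h l : Polynomial n) → Polynomial n
  detₚ a b c d e f g h l =
    a :* (e :* l :- f :* h) :- b :* (d :* l :- f :* g) :+ c :* (d :* h :- e :* g)

  crossₚ : Quat → Quat → Quat → Quat
  crossₚ (quat u₀ u₁ u₂ u₃) (quat v₀ v₁ v₂ v₃) (quat w₀ w₁ w₂ w₃) = quat
    (:- detₚ u₁ u₂ u₃ v₁ v₂ v₃ w₁ w₂ w₃)
    (detₚ u₀ u₂ u₃ v₀ v₂ v₃ w₀ w₂ w₃)
    (:- detₚ u₀ u₁ u₃ v₀ v₁ v₃ w₀ w₁ w₃)
    (detₚ u₀ u₁ u₂ v₀ v₁ v₂ w₀ w₁ w₂)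

  leftₚ rightₚ : Quat → Quat → Quat → Quat
  leftₚ α β γ =
    α ⊗ Imₚ (conjₚ γ ⊗ β) ⊕ (β ·ₚ α) ∙ₚ γ ⊕ (:- (γ ·ₚ α)) ∙ₚ β
  rightₚ α β γ =
    Imₚ (γ ⊗ conjₚ β) ⊗ α ⊕ (:- (β ·ₚ α)) ∙ₚ γ ⊕ (γ ·ₚ α) ∙ₚ β

  -- The solver settles one integer equation at a time, in variables supplied one by one; hence the
  -- coordinate selector `p` and the twelve curried arguments.
  equate : (Quat → Polynomial n) → (Quat → Quat → Quat → Quat) →
    (a₀ a₁ a₂ a₃ b₀ b₁ b₂ b₃ c₀ c₁ c₂ c₃ : Polynomial n) →
    Polynomial n and Polynomial n
  equate p f a₀ a₁ a₂ a₃ b₀ b₁ b₂ b₃ c₀ c₁ c₂ c₃ =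
    p (crossₚ α β γ) := p (f α β γ)
    where
    α β γ : Quat
    α = quat a₀ a₁ a₂ a₃
    β = quat b₀ b₁ b₂ b₃
    γ = quat c₀ c₁ c₂ c₃

open Symbolic using (equate; leftₚ; rightₚ; p₀; p₁; p₂; p₃)
open +-*-Solver using (solve)

-- Conjugation rules yield twice this identity; checking it as a polynomial identity in each
-- coordinate avoids halving.
×-⊛ˡ : ∀ α β γ →
  α × β × γ ≡ α ⊛ Im (conj γ ⊛ β) ⊞ (β · α) ∙ γ ⊞ (- (γ · α)) ∙ β
×-⊛ˡ (quat a₀ a₁ a₂ a₃) (quat b₀ b₁ b₂ b₃) (quat c₀ c₁ c₂ c₃) = quat-cong
  (solve 12 (equate p₀ leftₚ) refl a₀ a₁ a₂ a₃ b₀ b₁ b₂ b₃ c₀ c₁ c₂ c₃)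
  (solve 12 (equate p₁ leftₚ) refl a₀ a₁ a₂ a₃ b₀ b₁ b₂ b₃ c₀ c₁ c₂ c₃)
  (solve 12 (equate p₂ leftₚ) refl a₀ a₁ a₂ a₃ b₀ b₁ b₂ b₃ c₀ c₁ c₂ c₃)
  (solve 12 (equate p₃ leftₚ) refl a₀ a₁ a₂ a₃ b₀ b₁ b₂ b₃ c₀ c₁ c₂ c₃)

-- Here the subtracted product `α ⊛ conj β ⊛ γ` is the one rewritten, so the signs of both
-- corrections flip.
×-⊛ʳ : ∀ α β γ →
  α × β × γ ≡ Im (γ ⊛ conj β) ⊛ α ⊞ (- (β · α)) ∙ γ ⊞ (γ · α) ∙ β
×-⊛ʳ (quat a₀ a₁ a₂ a₃) (quat b₀ b₁ b₂ b₃) (quat c₀ c₁ c₂ c₃) = quat-cong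
  (solve 12 (equate p₀ rightₚ) refl a₀ a₁ a₂ a₃ b₀ b₁ b₂ b₃ c₀ c₁ c₂ c₃)
  (solve 12 (equate p₁ rightₚ) refl a₀ a₁ a₂ a₃ b₀ b₁ b₂ b₃ c₀ c₁ c₂ c₃)
  (solve 12 (equate p₂ rightₚ) refl a₀ a₁ a₂ a₃ b₀ b₁ b₂ b₃ c₀ c₁ c₂ c₃)
  (solve 12 (equate p₃ rightₚ) refl a₀ a₁ a₂ a₃ b₀ b₁ b₂ b₃ c₀ c₁ c₂ c₃)

theorem5p3 : (α β γ : 𝓛) → β ⟂ α → γ ⟂ α →
    (α × β × γ) ∈ ((α ⊛𝓛) ∩ (𝓛⊛ α))
theorem5p3 α β γ β⟂α γ⟂α =
    -- Orthogonality kills both corrections; `cong -_` covers the negated one, as `- 0ℤ` computes to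
    -- `0ℤ`.
    (Im (conj γ ⊛ β) , trans (×-⊛ˡ α β γ) (∙-vanishes _ γ β β⟂α (cong -_ γ⟂α)))
  , (Im (γ ⊛ conj β) , trans (×-⊛ʳ α β γ) (∙-vanishes _ γ β (cong -_ β⟂α) γ⟂α))
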